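{- Let $f \in \mathbb{Z}[x]$ be a polynomial of degree $d$. Then at least one of the polynomials $f(x)+t$, where $t \in \mathbb{Z}$ satisfies $|t| \le \lfloor d/2 \rfloor$, is square-free.
   Context: A polynomial $g \in \mathbb{Z}[x]$ is called square-free if there is no polynomial $h \in \mathbb{Z}[x]$ of degree at least $1$ such that $h^2$ divides $g$ (equivalently, $g$ has no multiple complex roots). -}

module Defs where

open import Data.Nat using (ℕ; zero; suc; _≤_; _<_)
open import Data.Integer using (ℤ; 0ℤ; _+_; _*_)
open import Data.List using (List; []; _∷_; map)
open import Data.List.Relation.Unary.All using (All)
open import Data.Product using (Σ; _×_; ∃)
open import Relation.Binary.PropositionalEquality using (_≡_; _≢_)
open import Relation.Nullary using (¬_)

-- A polynomial in ℤ[x], represented by its list of coefficients,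
-- constant term first: a₀ ∷ a₁ ∷ … ∷ aₙ ∷ [] stands for a₀ + a₁x + … + aₙxⁿ.
-- Trailing zeros are allowed; equality of polynomials is _≈ₚ_ below.
Poly : Set
Poly = List ℤ

coeff : Poly → ℕ → ℤ
coeff []      _       = 0ℤ
coeff (a ∷ p) zero    = a
coeff (a ∷ p) (suc i) = coeff p i

_≈ₚ_ : Poly → Poly → Set
[]      ≈ₚ q       = All (_≡ 0ℤ) q
(a ∷ p) ≈ₚ []      = All (_≡ 0ℤ) (a ∷ p)
(a ∷ p) ≈ₚ (b ∷ q) = (a ≡ b) × (p ≈ₚ q)

_+ₚ_ : Poly → Poly → Poly
[]      +ₚ q       = q
(a ∷ p) +ₚ []      = a ∷ p
(a ∷ p) +ₚ (b ∷ q) = (a + b) ∷ (p +ₚ q)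

_*ₚ_ : Poly → Poly → Poly
[]      *ₚ q = []
(a ∷ p) *ₚ q = map (a *_) q +ₚ (0ℤ ∷ (p *ₚ q))

addConst : ℤ → Poly → Poly
addConst t []      = t ∷ []
addConst t (a ∷ p) = (a + t) ∷ p

_∣ₚ_ : Poly → Poly → Set
h ∣ₚ g = ∃ λ k → (h *ₚ k) ≈ₚ g

HasDegree : Poly → ℕ → Set
HasDegree p d = (coeff p d ≢ 0ℤ) × (∀ i → d < i → coeff p i ≡ 0ℤ)

DegreeAtLeast1 : Poly → Set
DegreeAtLeast1 p = ∃ λ i → (1 ≤ i) × (coeff p i ≢ 0ℤ)

SquareFree : Poly → Set
SquareFree g = ¬ (∃ λ h → DegreeAtLeast1 h × ((h *ₚ h) ∣ₚ g))

module Submission where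

-- Work in ℚ[x], clearing denominators by nonzero integer scalars.
-- If g and its formal derivative g′ are coprime (u·g + v·g′ is a nonzero
-- constant), then g is square-free, because a square factor h² of g makes
-- h a factor of g′ too.  Otherwise Euclid's algorithm (run with
-- pseudo-division) produces a factor of positive degree shared by g and g′.
-- Apply this to the 2m+1 shifts gᵢ = f + (i − m), m = ⌊d/2⌋, which all have
-- derivative f′.  Distinct shifts differ by a nonzero constant, so factors
-- of distinct shifts are coprime; if every shift shared a factor with f′,
-- the product of these factors would divide f′, forcing 2m+1 ≤ d − 1.

open import Defs
open import Data.Nat using (ℕ; zero; suc; _+_; _∸_; _≤_; _<_; z≤n; s≤s; ⌊_/2⌋; ⌈_/2⌉)
import Data.Nat.Properties as ℕₚ
open import Data.Integer as ℤ using (ℤ; +_; 0ℤ; 1ℤ; ∣_∣)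
import Data.Integer.Properties as ℤₚ
open import Algebra.Properties.AbelianGroup ℤₚ.+-0-abelianGroup using () renaming (∙-cancelʳ to +-cancelʳ)
open import Data.Integer.Tactic.RingSolver using () renaming (solve-∀ to ℤ-solve-∀)
open import Data.List using ([]; _∷_; map; drop; length)
open import Data.List.Relation.Unary.All using (All; []; _∷_)
open import Data.Maybe using (Maybe; just; nothing)
open import Data.Product using (∃; _×_; _,_; proj₁; proj₂)
open import Data.Sum using (_⊎_; inj₁; inj₂; [_,_]; [_,_]′) renaming (map to ⊎-map)
open import Data.Empty using (⊥; ⊥-elim)
open import Function using (_∘_)
open import Relation.Nullary using (yes; no)
open import Relation.Binary.PropositionalEquality
  using (_≡_; _≢_; refl; sym; trans; cong; cong₂; subst; module ≡-Reasoning)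
open import Relation.Binary.Definitions using (tri<; tri≈; tri>)
open import Relation.Binary.Structures using (IsEquivalence)
open import Relation.Binary.Bundles using (Setoid)
import Relation.Binary.Reasoning.Setoid as SetoidReasoning
open import Tactic.RingSolver using (solve-∀)
open import Tactic.RingSolver.Core.AlmostCommutativeRing using (AlmostCommutativeRing; fromCommutativeRing)

-- §1.  Coefficientwise equality and the commutative ring ℤ[x].

-- This is the equality used throughout; it agrees
-- with the frozen _≈ₚ_ (see ≈ₚ⇒≐) but is far easier to reason with.
infix 4 _≐_
record _≐_ (p q : Poly) : Set where
  constructor mk≐
  field coeff-≡ : ∀ i → coeff p i ≡ coeff q i
open _≐_

≐-refl : ∀ {p} → p ≐ p
≐-refl = mk≐ λ _ → refl

≐-sym : ∀ {p q} → p ≐ q → q ≐ p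
≐-sym p≐q = mk≐ λ i → sym (coeff-≡ p≐q i)

≐-trans : ∀ {p q r} → p ≐ q → q ≐ r → p ≐ r
≐-trans p≐q q≐r = mk≐ λ i → trans (coeff-≡ p≐q i) (coeff-≡ q≐r i)

≐-isEquivalence : IsEquivalence _≐_
≐-isEquivalence = record { refl = ≐-refl ; sym = ≐-sym ; trans = ≐-trans }

≐-setoid : Setoid _ _
≐-setoid = record { isEquivalence = ≐-isEquivalence }

module ≐-Reasoning = SetoidReasoning ≐-setoid

_·ₚ_ : ℤ → Poly → Poly
c ·ₚ p = map (c ℤ.*_) p

-ₚ_ : Poly → Poly
-ₚ p = map ℤ.-_ p

oneₚ : Poly
oneₚ = 1ℤ ∷ []

K : ℤ → Poly
K c = c ∷ []

Xₚ : Poly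
Xₚ = 0ℤ ∷ 1ℤ ∷ []

coeff-+ₚ : ∀ p q i → coeff (p +ₚ q) i ≡ coeff p i ℤ.+ coeff q i
coeff-+ₚ []      q       i       = sym (ℤₚ.+-identityˡ _)
coeff-+ₚ (a ∷ p) []      i       = sym (ℤₚ.+-identityʳ _)
coeff-+ₚ (a ∷ p) (b ∷ q) zero    = refl
coeff-+ₚ (a ∷ p) (b ∷ q) (suc i) = coeff-+ₚ p q i

coeff-·ₚ : ∀ c p i → coeff (c ·ₚ p) i ≡ c ℤ.* coeff p i
coeff-·ₚ c []      i       = sym (ℤₚ.*-zeroʳ c)
coeff-·ₚ c (a ∷ p) zero    = refl
coeff-·ₚ c (a ∷ p) (suc i) = coeff-·ₚ c p i

coeff--ₚ : ∀ p i → coeff (-ₚ p) i ≡ ℤ.- coeff p i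
coeff--ₚ []      i       = refl
coeff--ₚ (a ∷ p) zero    = refl
coeff--ₚ (a ∷ p) (suc i) = coeff--ₚ p i

coeff-*ₚ-zero : ∀ a p q → coeff ((a ∷ p) *ₚ q) 0 ≡ a ℤ.* coeff q 0
coeff-*ₚ-zero a p q =
  trans (coeff-+ₚ (a ·ₚ q) (0ℤ ∷ (p *ₚ q)) 0) (trans (ℤₚ.+-identityʳ _) (coeff-·ₚ a q 0))

coeff-*ₚ-suc : ∀ a p q j →
  coeff ((a ∷ p) *ₚ q) (suc j) ≡ a ℤ.* coeff q (suc j) ℤ.+ coeff (p *ₚ q) j
coeff-*ₚ-suc a p q j =
  trans (coeff-+ₚ (a ·ₚ q) (0ℤ ∷ (p *ₚ q)) (suc j)) (cong (ℤ._+ coeff (p *ₚ q) j) (coeff-·ₚ a q (suc j)))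

coeff-K*ₚ : ∀ c p i → coeff (K c *ₚ p) i ≡ c ℤ.* coeff p i
coeff-K*ₚ c p zero    = coeff-*ₚ-zero c [] p
coeff-K*ₚ c p (suc j) = trans (coeff-*ₚ-suc c [] p j) (ℤₚ.+-identityʳ _)

∷-cong : ∀ {a b p q} → a ≡ b → p ≐ q → (a ∷ p) ≐ (b ∷ q)
∷-cong a≡b p≐q = mk≐ λ { zero → a≡b ; (suc i) → coeff-≡ p≐q i }

∷-tail : ∀ {a p q} → (a ∷ p) ≐ q → p ≐ drop 1 q
∷-tail {q = []}    h = mk≐ λ i → coeff-≡ h (suc i)
∷-tail {q = _ ∷ _} h = mk≐ λ i → coeff-≡ h (suc i)

+ₚ-cong : ∀ {p p′ q q′} → p ≐ p′ → q ≐ q′ → (p +ₚ q) ≐ (p′ +ₚ q′)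
+ₚ-cong {p} {p′} {q} {q′} p≐p′ q≐q′ = mk≐ λ i →
  trans (coeff-+ₚ p q i) (trans (cong₂ ℤ._+_ (coeff-≡ p≐p′ i) (coeff-≡ q≐q′ i)) (sym (coeff-+ₚ p′ q′ i)))

-ₚ-cong : ∀ {p q} → p ≐ q → (-ₚ p) ≐ (-ₚ q)
-ₚ-cong {p} {q} p≐q = mk≐ λ i →
  trans (coeff--ₚ p i) (trans (cong ℤ.-_ (coeff-≡ p≐q i)) (sym (coeff--ₚ q i)))

+ₚ-assoc : ∀ p q r → ((p +ₚ q) +ₚ r) ≐ (p +ₚ (q +ₚ r))
+ₚ-assoc p q r = mk≐ λ i → begin
  coeff ((p +ₚ q) +ₚ r) i              ≡⟨ coeff-+ₚ (p +ₚ q) r i ⟩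
  coeff (p +ₚ q) i ℤ.+ coeff r i       ≡⟨ cong (ℤ._+ coeff r i) (coeff-+ₚ p q i) ⟩
  coeff p i ℤ.+ coeff q i ℤ.+ coeff r i ≡⟨ ℤₚ.+-assoc (coeff p i) _ _ ⟩
  coeff p i ℤ.+ (coeff q i ℤ.+ coeff r i) ≡⟨ cong (ℤ._+_ (coeff p i)) (coeff-+ₚ q r i) ⟨
  coeff p i ℤ.+ coeff (q +ₚ r) i       ≡⟨ coeff-+ₚ p (q +ₚ r) i ⟨
  coeff (p +ₚ (q +ₚ r)) i              ∎
  where open ≡-Reasoning

+ₚ-comm : ∀ p q → (p +ₚ q) ≐ (q +ₚ p)
+ₚ-comm p q = mk≐ λ i →
  trans (coeff-+ₚ p q i) (trans (ℤₚ.+-comm (coeff p i) _) (sym (coeff-+ₚ q p i)))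

+ₚ-identityʳ : ∀ p → (p +ₚ []) ≐ p
+ₚ-identityʳ p = mk≐ λ i → trans (coeff-+ₚ p [] i) (ℤₚ.+-identityʳ _)

-ₚ-inverseˡ : ∀ p → ((-ₚ p) +ₚ p) ≐ []
-ₚ-inverseˡ p = mk≐ λ i →
  trans (coeff-+ₚ (-ₚ p) p i) (trans (cong (ℤ._+ coeff p i) (coeff--ₚ p i)) (ℤₚ.+-inverseˡ (coeff p i)))

*ₚ-zeroˡ : ∀ p q → p ≐ [] → (p *ₚ q) ≐ []
*ₚ-zeroˡ []      q p≐0 = ≐-refl
*ₚ-zeroˡ (a ∷ p) q p≐0 = mk≐ λ
  { zero    → trans (coeff-*ₚ-zero a p q) (cong (ℤ._* coeff q 0) (coeff-≡ p≐0 0))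
  ; (suc j) → trans (coeff-*ₚ-suc a p q j)
      (cong₂ ℤ._+_ (cong (ℤ._* coeff q (suc j)) (coeff-≡ p≐0 0)) (coeff-≡ (*ₚ-zeroˡ p q (∷-tail p≐0)) j)) }

*ₚ-congʳ : ∀ {p p′} q → p ≐ p′ → (p *ₚ q) ≐ (p′ *ₚ q)
*ₚ-congʳ {[]}    {p′}     q p≐p′ = ≐-sym (*ₚ-zeroˡ p′ q (≐-sym p≐p′))
*ₚ-congʳ {a ∷ p} {[]}     q p≐p′ = *ₚ-zeroˡ (a ∷ p) q p≐p′
*ₚ-congʳ {a ∷ p} {b ∷ p′} q p≐p′ = mk≐ λ
  { zero    → trans (coeff-*ₚ-zero a p q)
      (trans (cong (ℤ._* coeff q 0) (coeff-≡ p≐p′ 0)) (sym (coeff-*ₚ-zero b p′ q)))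
  ; (suc j) → trans (coeff-*ₚ-suc a p q j)
      (trans (cong₂ ℤ._+_ (cong (ℤ._* coeff q (suc j)) (coeff-≡ p≐p′ 0)) (coeff-≡ (*ₚ-congʳ q (∷-tail p≐p′)) j))
             (sym (coeff-*ₚ-suc b p′ q j))) }

*ₚ-zeroʳ : ∀ p → (p *ₚ []) ≐ []
*ₚ-zeroʳ []      = ≐-refl
*ₚ-zeroʳ (a ∷ p) = mk≐ λ { zero → refl ; (suc i) → coeff-≡ (*ₚ-zeroʳ p) i }

*ₚ-∷ʳ : ∀ p b r → (p *ₚ (b ∷ r)) ≐ ((b ·ₚ p) +ₚ (0ℤ ∷ (p *ₚ r)))
*ₚ-∷ʳ []      b r = mk≐ λ { zero → refl ; (suc i) → refl }
*ₚ-∷ʳ (a ∷ p) b r = mk≐ λ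
  { zero    → trans (coeff-*ₚ-zero a p (b ∷ r)) (trans (ℤₚ.*-comm a b) (sym (ℤₚ.+-identityʳ _)))
  ; (suc j) → higher j }
  where
  open ≡-Reasoning
  swap : ∀ x y z → x ℤ.+ (y ℤ.+ z) ≡ y ℤ.+ (x ℤ.+ z)
  swap = ℤ-solve-∀
  higher : ∀ j → coeff ((a ∷ p) *ₚ (b ∷ r)) (suc j) ≡ coeff ((b ·ₚ (a ∷ p)) +ₚ (0ℤ ∷ ((a ∷ p) *ₚ r))) (suc j)
  higher j = begin
    coeff ((a ∷ p) *ₚ (b ∷ r)) (suc j)
      ≡⟨ coeff-*ₚ-suc a p (b ∷ r) j ⟩
    a ℤ.* coeff r j ℤ.+ coeff (p *ₚ (b ∷ r)) j
      ≡⟨ cong (ℤ._+_ (a ℤ.* coeff r j)) (trans (coeff-≡ (*ₚ-∷ʳ p b r) j) (coeff-+ₚ (b ·ₚ p) (0ℤ ∷ (p *ₚ r)) j)) ⟩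
    a ℤ.* coeff r j ℤ.+ (coeff (b ·ₚ p) j ℤ.+ coeff (0ℤ ∷ (p *ₚ r)) j)
      ≡⟨ swap (a ℤ.* coeff r j) (coeff (b ·ₚ p) j) _ ⟩
    coeff (b ·ₚ p) j ℤ.+ (a ℤ.* coeff r j ℤ.+ coeff (0ℤ ∷ (p *ₚ r)) j)
      ≡⟨ cong (ℤ._+_ (coeff (b ·ₚ p) j)) (trans (cong (ℤ._+ coeff (0ℤ ∷ (p *ₚ r)) j) (sym (coeff-·ₚ a r j)))
                                            (sym (coeff-+ₚ (a ·ₚ r) (0ℤ ∷ (p *ₚ r)) j))) ⟩
    coeff (b ·ₚ p) j ℤ.+ coeff ((a ∷ p) *ₚ r) j
      ≡⟨ coeff-+ₚ (b ·ₚ p) ((a ∷ p) *ₚ r) j ⟨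
    coeff ((b ·ₚ p) +ₚ ((a ∷ p) *ₚ r)) j ∎

*ₚ-comm : ∀ p q → (p *ₚ q) ≐ (q *ₚ p)
*ₚ-comm []      q = ≐-sym (*ₚ-zeroʳ q)
*ₚ-comm (a ∷ p) q = ≐-sym (≐-trans (*ₚ-∷ʳ q a p) (+ₚ-cong ≐-refl (∷-cong refl (*ₚ-comm q p))))

*ₚ-cong : ∀ {p p′ q q′} → p ≐ p′ → q ≐ q′ → (p *ₚ q) ≐ (p′ *ₚ q′)
*ₚ-cong {p} {p′} {q} {q′} p≐p′ q≐q′ =
  ≐-trans (*ₚ-congʳ q p≐p′) (≐-trans (*ₚ-comm p′ q) (≐-trans (*ₚ-congʳ p′ q≐q′) (*ₚ-comm q′ p′)))

*ₚ-congˡ : ∀ p {q q′} → q ≐ q′ → (p *ₚ q) ≐ (p *ₚ q′)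
*ₚ-congˡ p = *ₚ-cong (≐-refl {p})

+ₚ-congˡ : ∀ p {q q′} → q ≐ q′ → (p +ₚ q) ≐ (p +ₚ q′)
+ₚ-congˡ p = +ₚ-cong (≐-refl {p})

+ₚ-congʳ : ∀ {p p′} q → p ≐ p′ → (p +ₚ q) ≐ (p′ +ₚ q)
+ₚ-congʳ q p≐p′ = +ₚ-cong p≐p′ (≐-refl {q})

*ₚ-distribʳ : ∀ r p q → ((p +ₚ q) *ₚ r) ≐ ((p *ₚ r) +ₚ (q *ₚ r))
*ₚ-distribʳ r []      q       = ≐-refl
*ₚ-distribʳ r (a ∷ p) []      = ≐-sym (+ₚ-identityʳ _)
*ₚ-distribʳ r (a ∷ p) (b ∷ q) = mk≐ λ
  { zero    → trans (coeff-*ₚ-zero (a ℤ.+ b) (p +ₚ q) r)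
      (trans (ℤₚ.*-distribʳ-+ (coeff r 0) a b)
      (trans (cong₂ ℤ._+_ (sym (coeff-*ₚ-zero a p r)) (sym (coeff-*ₚ-zero b q r)))
             (sym (coeff-+ₚ ((a ∷ p) *ₚ r) ((b ∷ q) *ₚ r) 0))))
  ; (suc j) → trans (coeff-*ₚ-suc (a ℤ.+ b) (p +ₚ q) r j)
      (trans (cong (ℤ._+_ ((a ℤ.+ b) ℤ.* coeff r (suc j)))
                   (trans (coeff-≡ (*ₚ-distribʳ r p q) j) (coeff-+ₚ (p *ₚ r) (q *ₚ r) j)))
      (trans (interchange a b (coeff r (suc j)) _ _)
      (trans (cong₂ ℤ._+_ (sym (coeff-*ₚ-suc a p r j)) (sym (coeff-*ₚ-suc b q r j)))
             (sym (coeff-+ₚ ((a ∷ p) *ₚ r) ((b ∷ q) *ₚ r) (suc j)))))) }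
  where
  interchange : ∀ a b c s t → (a ℤ.+ b) ℤ.* c ℤ.+ (s ℤ.+ t) ≡ (a ℤ.* c ℤ.+ s) ℤ.+ (b ℤ.* c ℤ.+ t)
  interchange = ℤ-solve-∀

·ₚ-*ₚ : ∀ c p q → (c ·ₚ (p *ₚ q)) ≐ ((c ·ₚ p) *ₚ q)
·ₚ-*ₚ c []      q = ≐-refl
·ₚ-*ₚ c (a ∷ p) q = mk≐ λ
  { zero    → trans (coeff-·ₚ c ((a ∷ p) *ₚ q) 0)
      (trans (cong (c ℤ.*_) (coeff-*ₚ-zero a p q))
      (trans (sym (ℤₚ.*-assoc c a _)) (sym (coeff-*ₚ-zero (c ℤ.* a) (c ·ₚ p) q))))
  ; (suc j) → trans (coeff-·ₚ c ((a ∷ p) *ₚ q) (suc j))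
      (trans (cong (c ℤ.*_) (coeff-*ₚ-suc a p q j))
      (trans (distribute c a _ _)
      (trans (cong (ℤ._+_ (c ℤ.* a ℤ.* coeff q (suc j)))
                   (trans (sym (coeff-·ₚ c (p *ₚ q) j)) (coeff-≡ (·ₚ-*ₚ c p q) j)))
             (sym (coeff-*ₚ-suc (c ℤ.* a) (c ·ₚ p) q j))))) }
  where
  distribute : ∀ c a x y → c ℤ.* (a ℤ.* x ℤ.+ y) ≡ c ℤ.* a ℤ.* x ℤ.+ c ℤ.* y
  distribute = ℤ-solve-∀

0∷-*ₚ : ∀ p q → ((0ℤ ∷ p) *ₚ q) ≐ (0ℤ ∷ (p *ₚ q))
0∷-*ₚ p q = mk≐ λ
  { zero    → coeff-*ₚ-zero 0ℤ p q
  ; (suc j) → trans (coeff-*ₚ-suc 0ℤ p q j) (ℤₚ.+-identityˡ _) }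

*ₚ-assoc : ∀ p q r → ((p *ₚ q) *ₚ r) ≐ (p *ₚ (q *ₚ r))
*ₚ-assoc []      q r = ≐-refl
*ₚ-assoc (a ∷ p) q r =
  ≐-trans (*ₚ-distribʳ r (a ·ₚ q) (0ℤ ∷ (p *ₚ q)))
          (+ₚ-cong (≐-sym (·ₚ-*ₚ a q r)) (≐-trans (0∷-*ₚ (p *ₚ q) r) (∷-cong refl (*ₚ-assoc p q r))))

*ₚ-identityˡ : ∀ p → (oneₚ *ₚ p) ≐ p
*ₚ-identityˡ p = mk≐ λ i → trans (coeff-K*ₚ 1ℤ p i) (ℤₚ.*-identityˡ _)

open import Algebra.Structures {A = Poly} _≐_ using (IsCommutativeRing)
open import Algebra.Consequences.Setoid ≐-setoid using (comm∧idˡ⇒id; comm∧distrʳ⇒distr)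

ℤ[x]-isCommutativeRing : IsCommutativeRing _+ₚ_ _*ₚ_ -ₚ_ [] oneₚ
ℤ[x]-isCommutativeRing = record
  { isRing = record
    { +-isAbelianGroup = record
      { isGroup = record
        { isMonoid = record
          { isSemigroup = record
            { isMagma = record { isEquivalence = ≐-isEquivalence ; ∙-cong = +ₚ-cong }
            ; assoc = +ₚ-assoc }
          ; identity = (λ _ → ≐-refl) , +ₚ-identityʳ }
        ; inverse = -ₚ-inverseˡ , λ p → ≐-trans (+ₚ-comm p (-ₚ p)) (-ₚ-inverseˡ p)
        ; ⁻¹-cong = -ₚ-cong }
      ; comm = +ₚ-comm }
    ; *-cong = *ₚ-cong
    ; *-assoc = *ₚ-assoc
    ; *-identity = comm∧idˡ⇒id *ₚ-comm *ₚ-identityˡ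
    ; distrib = comm∧distrʳ⇒distr +ₚ-cong *ₚ-comm *ₚ-distribʳ }
  ; *-comm = *ₚ-comm }

-- A (partial) zero test, required to instantiate the ring solver.
≐[]? : (p : Poly) → Maybe ([] ≐ p)
≐[]? []      = just ≐-refl
≐[]? (a ∷ p) with a ℤ.≟ 0ℤ | ≐[]? p
... | yes a≡0 | just p≐0 = just (mk≐ λ { zero → sym a≡0 ; (suc i) → coeff-≡ p≐0 i })
... | _       | _        = nothing

-- ℤ[x] as a ring for the reflective solver: `solve-∀ ℤ[x]` proves any
-- commutative-ring identity between polynomial expressions.
ℤ[x] : AlmostCommutativeRing _ _
ℤ[x] = fromCommutativeRing (record { isCommutativeRing = ℤ[x]-isCommutativeRing }) ≐[]?

-- §2.  Constants, the variable x, and degrees.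

K-*ₚ-K : ∀ a b → (K a *ₚ K b) ≐ K (a ℤ.* b)
K-*ₚ-K a b = mk≐ λ i → trans (coeff-K*ₚ a (K b) i) (higher i)
  where
  higher : ∀ i → a ℤ.* coeff (K b) i ≡ coeff (K (a ℤ.* b)) i
  higher zero    = refl
  higher (suc i) = ℤₚ.*-zeroʳ a

Xₚ-*ₚ : ∀ p → (Xₚ *ₚ p) ≐ (0ℤ ∷ p)
Xₚ-*ₚ p = ≐-trans (0∷-*ₚ oneₚ p) (∷-cong refl (*ₚ-identityˡ p))

∷-as-sum : ∀ a p → (a ∷ p) ≐ (K a +ₚ (Xₚ *ₚ p))
∷-as-sum a p = ≐-trans (∷-cong (sym (ℤₚ.+-identityʳ a)) ≐-refl) (+ₚ-congˡ (K a) (≐-sym (Xₚ-*ₚ p)))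

addConst-as-sum : ∀ t f → addConst t f ≐ (f +ₚ K t)
addConst-as-sum t []      = ≐-refl
addConst-as-sum t (a ∷ f) = ∷-cong refl (≐-sym (+ₚ-identityʳ f))

addConst-zero : ∀ f → addConst 0ℤ f ≐ f
addConst-zero []      = mk≐ λ { zero → refl ; (suc i) → refl }
addConst-zero (a ∷ f) = ∷-cong (ℤₚ.+-identityʳ a) ≐-refl

≈ₚ⇒≐ : ∀ p q → p ≈ₚ q → p ≐ q
≈ₚ⇒≐ []      q       all0       = zeros all0
  where
  zeros : ∀ {q} → All (_≡ 0ℤ) q → [] ≐ q
  zeros []         = ≐-refl
  zeros (b≡0 ∷ bs) = mk≐ λ { zero → sym b≡0 ; (suc i) → coeff-≡ (zeros bs) i }
≈ₚ⇒≐ (a ∷ p) []      all0       = ≐-sym (≈ₚ⇒≐ [] (a ∷ p) all0)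
≈ₚ⇒≐ (a ∷ p) (b ∷ q) (a≡b , p≈q) = ∷-cong a≡b (≈ₚ⇒≐ p q p≈q)

*-≢0 : ∀ {a b} → a ≢ 0ℤ → b ≢ 0ℤ → a ℤ.* b ≢ 0ℤ
*-≢0 {a} a≢0 b≢0 ab≡0 = [ a≢0 , b≢0 ] (ℤₚ.i*j≡0⇒i≡0∨j≡0 a ab≡0)

DegreeAtLeast : ℕ → Poly → Set
DegreeAtLeast n p = ∃ λ k → n ≤ k × HasDegree p k

-- All coefficients of index ≥ n vanish: p = 0 or deg p < n.
Small : ℕ → Poly → Set
Small n p = ∀ i → n ≤ i → coeff p i ≡ 0ℤ

Small-length : ∀ p → Small (length p) p
Small-length []      i       _         = refl
Small-length (a ∷ p) (suc i) (s≤s n≤i) = Small-length p i n≤i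

HasDegree-resp : ∀ {p q n} → p ≐ q → HasDegree p n → HasDegree q n
HasDegree-resp p≐q (lead , high) =
  (λ e → lead (trans (coeff-≡ p≐q _) e)) , λ i n<i → trans (sym (coeff-≡ p≐q i)) (high i n<i)

zero-or-degree : ∀ p → p ≐ [] ⊎ ∃ (HasDegree p)
zero-or-degree []      = inj₁ ≐-refl
zero-or-degree (a ∷ p) with zero-or-degree p
... | inj₂ (n , lead , high) = inj₂ (suc n , lead , λ { zero () ; (suc i) (s≤s n<i) → high i n<i })
... | inj₁ p≐0 with a ℤ.≟ 0ℤ
...   | yes a≡0 = inj₁ (mk≐ λ { zero → a≡0 ; (suc i) → coeff-≡ p≐0 i })
...   | no  a≢0 = inj₂ (0 , a≢0 , λ { zero () ; (suc i) _ → coeff-≡ p≐0 i })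

degree-unique : ∀ {p m n} → HasDegree p m → HasDegree p n → m ≡ n
degree-unique {m = m} {n} (lead-m , high-m) (lead-n , high-n) with ℕₚ.<-cmp m n
... | tri< m<n _ _ = ⊥-elim (lead-n (high-m n m<n))
... | tri≈ _ m≡n _ = m≡n
... | tri> _ _ n<m = ⊥-elim (lead-m (high-n m n<m))

degree<Small : ∀ {p m n} → HasDegree p m → Small n p → m < n
degree<Small {m = m} {n} (lead , _) small with m ℕₚ.<? n
... | yes m<n = m<n
... | no  m≮n = ⊥-elim (lead (small m (ℕₚ.≮⇒≥ m≮n)))

nonzero-coeff⇒DegreeAtLeast : ∀ {n p} → (∃ λ i → n ≤ i × coeff p i ≢ 0ℤ) → DegreeAtLeast n p
nonzero-coeff⇒DegreeAtLeast {n} {p} (i , n≤i , pᵢ≢0) with zero-or-degree p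
... | inj₁ p≐0        = ⊥-elim (pᵢ≢0 (coeff-≡ p≐0 i))
... | inj₂ (k , p-deg) = k , ℕₚ.≤-trans n≤i (ℕₚ.≮⇒≥ λ k<i → pᵢ≢0 (proj₂ p-deg i k<i)) , p-deg

HasDegree-K*ₚ : ∀ {a q n} → a ≢ 0ℤ → HasDegree q n → HasDegree (K a *ₚ q) n
HasDegree-K*ₚ {a} {q} {n} a≢0 (lead , high) =
  (λ e → *-≢0 a≢0 lead (trans (sym (coeff-K*ₚ a q n)) e)) ,
  λ i n<i → trans (coeff-K*ₚ a q i) (trans (cong (a ℤ.*_) (high i n<i)) (ℤₚ.*-zeroʳ a))

HasDegree-*ₚ : ∀ {p q m n} → HasDegree p m → HasDegree q n → HasDegree (p *ₚ q) (m + n)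
HasDegree-*ₚ {[]}    (lead , _) _ = ⊥-elim (lead refl)
HasDegree-*ₚ {a ∷ p} {q} {zero} (lead , high) q-deg =
  HasDegree-resp {K a *ₚ q} (*ₚ-congʳ q (≐-sym (∷-cong {a} refl p≐0))) (HasDegree-K*ₚ {q = q} lead q-deg)
  where
  p≐0 : p ≐ []
  p≐0 = mk≐ λ j → high (suc j) (s≤s z≤n)
HasDegree-*ₚ {a ∷ p} {q} {suc m} {n} (lead , high) q-deg@(_ , q-high)
  with HasDegree-*ₚ {p} {q} {m} {n} (lead , λ i m<i → high (suc i) (s≤s m<i)) q-deg
... | lead′ , high′ =
  (λ e → lead′ (trans (sym (shift ℕₚ.≤-refl)) e)) ,
  λ { zero () ; (suc j) (s≤s m+n<j) → trans (shift (ℕₚ.<⇒≤ m+n<j)) (high′ j m+n<j) }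
  where
  -- above degree m + n, the term a·q of (a ∷ p)·q = a·q + x·(p·q) vanishes
  shift : ∀ {j} → m + n ≤ j → coeff ((a ∷ p) *ₚ q) (suc j) ≡ coeff (p *ₚ q) j
  shift {j} m+n≤j = trans (coeff-*ₚ-suc a p q j)
    (trans (cong (λ c → a ℤ.* c ℤ.+ coeff (p *ₚ q) j) (q-high (suc j) (s≤s (ℕₚ.≤-trans (ℕₚ.m≤n+m n m) m+n≤j))))
           (trans (cong (ℤ._+ coeff (p *ₚ q) j) (ℤₚ.*-zeroʳ a)) (ℤₚ.+-identityˡ _)))

DegreeAtLeast-*ₚ : ∀ {m n} P G → DegreeAtLeast m P → DegreeAtLeast n G → DegreeAtLeast (m + n) (P *ₚ G)
DegreeAtLeast-*ₚ P G (k , m≤k , P-deg) (l , n≤l , G-deg) =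
  k + l , ℕₚ.+-mono-≤ m≤k n≤l , HasDegree-*ₚ {P} {G} P-deg G-deg

degree-of-factor : ∀ {P Q F k n} → HasDegree P k → HasDegree F n → (P *ₚ Q) ≐ F → k ≤ n
degree-of-factor {P} {Q} {F} {k} P-deg F-deg PQ≐F with zero-or-degree Q
... | inj₁ Q≐0 = ⊥-elim (proj₁ F-deg (coeff-≡ F≐0 _))
  where
  F≐0 : F ≐ []
  F≐0 = ≐-trans (≐-sym PQ≐F) (≐-trans (*ₚ-comm P Q) (*ₚ-zeroˡ Q P Q≐0))
... | inj₂ (m , Q-deg) =
  subst (k ≤_) (sym (degree-unique {F} F-deg (HasDegree-resp {P *ₚ Q} PQ≐F (HasDegree-*ₚ {P} {Q} P-deg Q-deg)))) (ℕₚ.m≤m+n k m)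

-- §3.  Divisibility and coprimality in ℚ[x], denominators cleared.

-- G divides A in ℚ[x]:  G·k = c·A  for some k ∈ ℤ[x] and nonzero c ∈ ℤ.
infix 4 _∣ℚ_
record _∣ℚ_ (G A : Poly) : Set where
  constructor divides
  field
    scalar   : ℤ
    scalar≢0 : scalar ≢ 0ℤ
    cofactor : Poly
    equation : (G *ₚ cofactor) ≐ (K scalar *ₚ A)

-- A and B are coprime in ℚ[x]:  u·A + v·B  is a nonzero constant
-- (a Bézout relation with denominators cleared).
record Coprime (A B : Poly) : Set where
  constructor bezout
  field
    u        : Poly
    v        : Poly
    constant : ℤ
    constant≢0 : constant ≢ 0ℤ
    equation : ((u *ₚ A) +ₚ (v *ₚ B)) ≐ K constant

CommonFactor : Poly → Poly → Set
CommonFactor A B = ∃ λ G → DegreeAtLeast 1 G × G ∣ℚ A × G ∣ℚ B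

K-degree : ∀ {c} → c ≢ 0ℤ → HasDegree (K c) 0
K-degree c≢0 = c≢0 , λ { zero () ; (suc i) _ → refl }

K-*ₚ-K-*ₚ : ∀ a b F → (K a *ₚ (K b *ₚ F)) ≐ (K (a ℤ.* b) *ₚ F)
K-*ₚ-K-*ₚ a b F = ≐-trans (≐-sym (*ₚ-assoc (K a) (K b) F)) (*ₚ-congʳ F (K-*ₚ-K a b))

∣ℚ-resp : ∀ {G A A′} → G ∣ℚ A → A ≐ A′ → G ∣ℚ A′
∣ℚ-resp (divides c c≢0 k Gk≐cA) A≐A′ = divides c c≢0 k (≐-trans Gk≐cA (*ₚ-congˡ (K c) A≐A′))

∣ℚ-refl : ∀ G → G ∣ℚ G
∣ℚ-refl G = divides 1ℤ (λ ()) oneₚ (*ₚ-comm G oneₚ)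

∣ℚ-zero : ∀ G {A} → A ≐ [] → G ∣ℚ A
∣ℚ-zero G {A} A≐0 =
  divides 1ℤ (λ ()) [] (≐-trans (*ₚ-zeroʳ G) (≐-sym (≐-trans (*ₚ-comm oneₚ A) (*ₚ-zeroˡ A oneₚ A≐0))))

∣ℚ-+ : ∀ {G A B} → G ∣ℚ A → G ∣ℚ B → G ∣ℚ (A +ₚ B)
∣ℚ-+ {G} {A} {B} (divides c₁ c₁≢0 k₁ Gk₁≐c₁A) (divides c₂ c₂≢0 k₂ Gk₂≐c₂B) =
  divides (c₁ ℤ.* c₂) (*-≢0 c₁≢0 c₂≢0) ((K c₂ *ₚ k₁) +ₚ (K c₁ *ₚ k₂)) (begin
    G *ₚ ((K c₂ *ₚ k₁) +ₚ (K c₁ *ₚ k₂))          ≈⟨ regroup G (K c₁) (K c₂) k₁ k₂ ⟩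
    (K c₂ *ₚ (G *ₚ k₁)) +ₚ (K c₁ *ₚ (G *ₚ k₂))   ≈⟨ +ₚ-cong (*ₚ-congˡ (K c₂) Gk₁≐c₁A) (*ₚ-congˡ (K c₁) Gk₂≐c₂B) ⟩
    (K c₂ *ₚ (K c₁ *ₚ A)) +ₚ (K c₁ *ₚ (K c₂ *ₚ B)) ≈⟨ collect (K c₁) (K c₂) A B ⟩
    K c₁ *ₚ (K c₂ *ₚ (A +ₚ B))                   ≈⟨ K-*ₚ-K-*ₚ c₁ c₂ (A +ₚ B) ⟩
    K (c₁ ℤ.* c₂) *ₚ (A +ₚ B)                    ∎)
  where
  open ≐-Reasoning
  regroup : ∀ G a b k l → (G *ₚ ((b *ₚ k) +ₚ (a *ₚ l))) ≐ ((b *ₚ (G *ₚ k)) +ₚ (a *ₚ (G *ₚ l)))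
  regroup = solve-∀ ℤ[x]
  collect : ∀ a b A B → ((b *ₚ (a *ₚ A)) +ₚ (a *ₚ (b *ₚ B))) ≐ (a *ₚ (b *ₚ (A +ₚ B)))
  collect = solve-∀ ℤ[x]

∣ℚ-*ˡ : ∀ {G B} Q → G ∣ℚ B → G ∣ℚ (Q *ₚ B)
∣ℚ-*ˡ {G} {B} Q (divides c c≢0 k Gk≐cB) = divides c c≢0 (Q *ₚ k) (begin
  G *ₚ (Q *ₚ k)   ≈⟨ swap G Q k ⟩
  Q *ₚ (G *ₚ k)   ≈⟨ *ₚ-congˡ Q Gk≐cB ⟩
  Q *ₚ (K c *ₚ B) ≈⟨ swap Q (K c) B ⟩
  K c *ₚ (Q *ₚ B) ∎)
  where
  open ≐-Reasoning
  swap : ∀ a b c → (a *ₚ (b *ₚ c)) ≐ (b *ₚ (a *ₚ c))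
  swap = solve-∀ ℤ[x]

∣ℚ-cancel : ∀ {G s A} → s ≢ 0ℤ → G ∣ℚ (K s *ₚ A) → G ∣ℚ A
∣ℚ-cancel {s = s} {A} s≢0 (divides c c≢0 k Gk≐csA) =
  divides (c ℤ.* s) (*-≢0 c≢0 s≢0) k (≐-trans Gk≐csA (K-*ₚ-K-*ₚ c s A))

degree-of-∣ℚ : ∀ {P F k n} → HasDegree P k → HasDegree F n → P ∣ℚ F → k ≤ n
degree-of-∣ℚ {P} {F} P-deg F-deg (divides c c≢0 k Pk≐cF) =
  degree-of-factor {P = P} {F = K c *ₚ F} P-deg (HasDegree-K*ₚ {q = F} c≢0 F-deg) Pk≐cF

constant-coprime : ∀ A B → HasDegree A 0 → Coprime A B
constant-coprime A B (lead , high) = bezout oneₚ [] (coeff A 0) lead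
  (≐-trans (+ₚ-identityʳ _) (≐-trans (*ₚ-identityˡ A) (mk≐ λ { zero → refl ; (suc i) → high (suc i) (s≤s z≤n) })))

coprime⇒no-common-factor : ∀ {A B h w₁ w₂} → Coprime A B → DegreeAtLeast 1 h →
  (h *ₚ w₁) ≐ A → (h *ₚ w₂) ≐ B → ⊥
coprime⇒no-common-factor {A} {B} {h} {w₁} {w₂} (bezout u v c c≢0 uA+vB≐c) (k , 1≤k , h-deg) hw₁≐A hw₂≐B =
  ℕₚ.<⇒≱ 1≤k (degree-of-factor {P = h} {F = K c} h-deg (K-degree c≢0) (begin
    h *ₚ ((u *ₚ w₁) +ₚ (v *ₚ w₂))        ≈⟨ distribute h u v w₁ w₂ ⟩
    (u *ₚ (h *ₚ w₁)) +ₚ (v *ₚ (h *ₚ w₂)) ≈⟨ +ₚ-cong (*ₚ-congˡ u hw₁≐A) (*ₚ-congˡ v hw₂≐B) ⟩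
    (u *ₚ A) +ₚ (v *ₚ B)                 ≈⟨ uA+vB≐c ⟩
    K c                                  ∎))
  where
  open ≐-Reasoning
  distribute : ∀ h u v w₁ w₂ → (h *ₚ ((u *ₚ w₁) +ₚ (v *ₚ w₂))) ≐ ((u *ₚ (h *ₚ w₁)) +ₚ (v *ₚ (h *ₚ w₂)))
  distribute = solve-∀ ℤ[x]

coprime-∣ℚ : ∀ {P g G} → Coprime P g → G ∣ℚ g → Coprime P G
coprime-∣ℚ {P} {g} {G} (bezout u v E E≢0 uP+vg≐E) (divides c c≢0 k Gk≐cg) =
  bezout (K c *ₚ u) (v *ₚ k) (c ℤ.* E) (*-≢0 c≢0 E≢0) (begin
    ((K c *ₚ u) *ₚ P) +ₚ ((v *ₚ k) *ₚ G) ≈⟨ regroup (K c) u P v k G ⟩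
    (K c *ₚ (u *ₚ P)) +ₚ (v *ₚ (G *ₚ k)) ≈⟨ +ₚ-congˡ (K c *ₚ (u *ₚ P)) (*ₚ-congˡ v Gk≐cg) ⟩
    (K c *ₚ (u *ₚ P)) +ₚ (v *ₚ (K c *ₚ g)) ≈⟨ collect (K c) u P v g ⟩
    K c *ₚ ((u *ₚ P) +ₚ (v *ₚ g))        ≈⟨ *ₚ-congˡ (K c) uP+vg≐E ⟩
    K c *ₚ K E                           ≈⟨ K-*ₚ-K c E ⟩
    K (c ℤ.* E)                          ∎)
  where
  open ≐-Reasoning
  regroup : ∀ c u P v k G → (((c *ₚ u) *ₚ P) +ₚ ((v *ₚ k) *ₚ G)) ≐ ((c *ₚ (u *ₚ P)) +ₚ (v *ₚ (G *ₚ k)))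
  regroup = solve-∀ ℤ[x]
  collect : ∀ c u P v g → ((c *ₚ (u *ₚ P)) +ₚ (v *ₚ (c *ₚ g))) ≐ (c *ₚ ((u *ₚ P) +ₚ (v *ₚ g)))
  collect = solve-∀ ℤ[x]

-- Coprimality to g is preserved by products:  (uP + vg)(u′G + v′g) = E·e.
coprime-*ₚ : ∀ {P G g} → Coprime P g → Coprime G g → Coprime (P *ₚ G) g
coprime-*ₚ {P} {G} {g} (bezout u v E E≢0 uP+vg≐E) (bezout u′ v′ e e≢0 u′G+v′g≐e) =
  bezout (u *ₚ u′) (((u *ₚ P) *ₚ v′) +ₚ (v *ₚ ((u′ *ₚ G) +ₚ (v′ *ₚ g)))) (E ℤ.* e) (*-≢0 E≢0 e≢0) (begin
    ((u *ₚ u′) *ₚ (P *ₚ G)) +ₚ ((((u *ₚ P) *ₚ v′) +ₚ (v *ₚ ((u′ *ₚ G) +ₚ (v′ *ₚ g)))) *ₚ g)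
      ≈⟨ expand u u′ P G v v′ g ⟩
    ((u *ₚ P) +ₚ (v *ₚ g)) *ₚ ((u′ *ₚ G) +ₚ (v′ *ₚ g))
      ≈⟨ *ₚ-cong uP+vg≐E u′G+v′g≐e ⟩
    K E *ₚ K e
      ≈⟨ K-*ₚ-K E e ⟩
    K (E ℤ.* e) ∎)
  where
  open ≐-Reasoning
  expand : ∀ u u′ P G v v′ g →
    (((u *ₚ u′) *ₚ (P *ₚ G)) +ₚ ((((u *ₚ P) *ₚ v′) +ₚ (v *ₚ ((u′ *ₚ G) +ₚ (v′ *ₚ g)))) *ₚ g))
      ≐ (((u *ₚ P) +ₚ (v *ₚ g)) *ₚ ((u′ *ₚ G) +ₚ (v′ *ₚ g)))
  expand = solve-∀ ℤ[x]

-- A divisor of f + a is coprime to f + b when a ≠ b: the two differ by a nonzero constant.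
coprime-shift : ∀ {G f a b} → G ∣ℚ (f +ₚ K a) → a ≢ b → Coprime G (f +ₚ K b)
coprime-shift {G} {f} {a} {b} (divides c c≢0 k Gk≐c[f+a]) a≢b =
  bezout k (-ₚ (K c)) (c ℤ.* (a ℤ.- b)) (*-≢0 c≢0 (λ a-b≡0 → a≢b (ℤₚ.i-j≡0⇒i≡j a b a-b≡0))) (begin
    (k *ₚ G) +ₚ ((-ₚ (K c)) *ₚ (f +ₚ K b))  ≈⟨ regroup k G (K c) (f +ₚ K b) ⟩
    (G *ₚ k) +ₚ (-ₚ (K c *ₚ (f +ₚ K b)))    ≈⟨ +ₚ-congʳ (-ₚ (K c *ₚ (f +ₚ K b))) Gk≐c[f+a] ⟩
    (K c *ₚ (f +ₚ K a)) +ₚ (-ₚ (K c *ₚ (f +ₚ K b))) ≈⟨ cancel (K c) f (K a) (K b) ⟩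
    K c *ₚ K (a ℤ.- b)                      ≈⟨ K-*ₚ-K c (a ℤ.- b) ⟩
    K (c ℤ.* (a ℤ.- b))                     ∎)
  where
  open ≐-Reasoning
  regroup : ∀ k G c h → ((k *ₚ G) +ₚ ((-ₚ c) *ₚ h)) ≐ ((G *ₚ k) +ₚ (-ₚ (c *ₚ h)))
  regroup = solve-∀ ℤ[x]
  cancel : ∀ c f A B → ((c *ₚ (f +ₚ A)) +ₚ (-ₚ (c *ₚ (f +ₚ B)))) ≐ (c *ₚ (A +ₚ (-ₚ B)))
  cancel = solve-∀ ℤ[x]

-- Coprime divisors of F have their product dividing F: from P·k₁ = c₁F,
-- G·k₂ = c₂F and uP + vG = E we get PG·(c₁u·k₂ + c₂v·k₁) = E·c₁c₂·F.
∣ℚ-*ₚ : ∀ {P G F} → P ∣ℚ F → G ∣ℚ F → Coprime P G → (P *ₚ G) ∣ℚ F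
∣ℚ-*ₚ {P} {G} {F} (divides c₁ c₁≢0 k₁ Pk₁≐c₁F) (divides c₂ c₂≢0 k₂ Gk₂≐c₂F) (bezout u v E E≢0 uP+vG≐E) =
  divides (E ℤ.* (c₁ ℤ.* c₂)) (*-≢0 E≢0 (*-≢0 c₁≢0 c₂≢0)) ((K c₁ *ₚ (u *ₚ k₂)) +ₚ (K c₂ *ₚ (v *ₚ k₁))) (begin
    (P *ₚ G) *ₚ ((K c₁ *ₚ (u *ₚ k₂)) +ₚ (K c₂ *ₚ (v *ₚ k₁)))
      ≈⟨ regroup P G (K c₁) (K c₂) u v k₁ k₂ ⟩
    ((K c₁ *ₚ (u *ₚ P)) *ₚ (G *ₚ k₂)) +ₚ ((K c₂ *ₚ (v *ₚ G)) *ₚ (P *ₚ k₁))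
      ≈⟨ +ₚ-cong (*ₚ-congˡ (K c₁ *ₚ (u *ₚ P)) Gk₂≐c₂F) (*ₚ-congˡ (K c₂ *ₚ (v *ₚ G)) Pk₁≐c₁F) ⟩
    ((K c₁ *ₚ (u *ₚ P)) *ₚ (K c₂ *ₚ F)) +ₚ ((K c₂ *ₚ (v *ₚ G)) *ₚ (K c₁ *ₚ F))
      ≈⟨ collect P G (K c₁) (K c₂) u v F ⟩
    ((u *ₚ P) +ₚ (v *ₚ G)) *ₚ (K c₁ *ₚ (K c₂ *ₚ F))
      ≈⟨ *ₚ-cong uP+vG≐E (K-*ₚ-K-*ₚ c₁ c₂ F) ⟩
    K E *ₚ (K (c₁ ℤ.* c₂) *ₚ F)
      ≈⟨ K-*ₚ-K-*ₚ E (c₁ ℤ.* c₂) F ⟩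
    K (E ℤ.* (c₁ ℤ.* c₂)) *ₚ F ∎)
  where
  open ≐-Reasoning
  regroup : ∀ P G a b u v k₁ k₂ →
    ((P *ₚ G) *ₚ ((a *ₚ (u *ₚ k₂)) +ₚ (b *ₚ (v *ₚ k₁))))
      ≐ (((a *ₚ (u *ₚ P)) *ₚ (G *ₚ k₂)) +ₚ ((b *ₚ (v *ₚ G)) *ₚ (P *ₚ k₁)))
  regroup = solve-∀ ℤ[x]
  collect : ∀ P G a b u v F →
    (((a *ₚ (u *ₚ P)) *ₚ (b *ₚ F)) +ₚ ((b *ₚ (v *ₚ G)) *ₚ (a *ₚ F)))
      ≐ (((u *ₚ P) +ₚ (v *ₚ G)) *ₚ (a *ₚ (b *ₚ F)))
  collect = solve-∀ ℤ[x]

-- §4.  Pseudo-division and the Euclidean algorithm.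

cancel-top : ∀ {B S n} → HasDegree B n → Small (suc n) S →
  Small n ((K (coeff B n) *ₚ S) +ₚ (-ₚ (K (coeff S n) *ₚ B)))
cancel-top {B} {S} {n} (_ , B-high) S-small i n≤i =
  trans (coeff-combination i) (vanishes (ℕₚ.m≤n⇒m<n∨m≡n n≤i))
  where
  b σ : ℤ
  b = coeff B n
  σ = coeff S n
  coeff-combination : ∀ i → coeff ((K b *ₚ S) +ₚ (-ₚ (K σ *ₚ B))) i ≡ b ℤ.* coeff S i ℤ.+ ℤ.- (σ ℤ.* coeff B i)
  coeff-combination i = trans (coeff-+ₚ (K b *ₚ S) (-ₚ (K σ *ₚ B)) i)
    (cong₂ ℤ._+_ (coeff-K*ₚ b S i) (trans (coeff--ₚ (K σ *ₚ B) i) (cong ℤ.-_ (coeff-K*ₚ σ B i))))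
  vanishes : ∀ {i} → n < i ⊎ n ≡ i → b ℤ.* coeff S i ℤ.+ ℤ.- (σ ℤ.* coeff B i) ≡ 0ℤ
  vanishes {i} (inj₁ n<i) =
    trans (cong₂ (λ x y → b ℤ.* x ℤ.+ ℤ.- (σ ℤ.* y)) (S-small i n<i) (B-high i n<i))
          (cong₂ (λ x y → x ℤ.+ ℤ.- y) (ℤₚ.*-zeroʳ b) (ℤₚ.*-zeroʳ σ))
  vanishes (inj₂ refl) = trans (cong (λ x → b ℤ.* σ ℤ.+ ℤ.- x) (ℤₚ.*-comm σ b)) (ℤₚ.+-inverseʳ (b ℤ.* σ))

-- Induction on A = a + x·A′: from s·A′ = Q·B + R, the polynomial
-- S = s·a + x·R is Small (n+1), and one cancellation step finishes.
pseudo-divide : ∀ {B n} → HasDegree B n → (A : Poly) →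
  ∃ λ s → s ≢ 0ℤ × ∃ λ Q → ∃ λ R → (K s *ₚ A) ≐ ((Q *ₚ B) +ₚ R) × Small n R
pseudo-divide B-deg [] = 1ℤ , (λ ()) , [] , [] , *ₚ-zeroʳ oneₚ , λ _ _ → refl
pseudo-divide {B} {n} B-deg (a ∷ A) with pseudo-divide B-deg A
... | s , s≢0 , Q , R , sA≐QB+R , R-small =
  b ℤ.* s , *-≢0 (proj₁ B-deg) s≢0 , (K b *ₚ (Xₚ *ₚ Q)) +ₚ K σ , (K b *ₚ S) +ₚ (-ₚ (K σ *ₚ B)) ,
  equation , cancel-top {B} {S} B-deg S-small
  where
  b σ : ℤ
  S : Poly
  b = coeff B n
  S = (K s *ₚ K a) +ₚ (Xₚ *ₚ R)
  σ = coeff S n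
  S-small : Small (suc n) S
  S-small (suc j) (s≤s n≤j) = trans (coeff-+ₚ (K s *ₚ K a) (Xₚ *ₚ R) (suc j))
    (cong₂ ℤ._+_ (trans (coeff-K*ₚ s (K a) (suc j)) (ℤₚ.*-zeroʳ s)) (trans (coeff-≡ (Xₚ-*ₚ R) (suc j)) (R-small j n≤j)))
  open ≐-Reasoning
  expand : ∀ b s a X A → ((b *ₚ s) *ₚ (a +ₚ (X *ₚ A))) ≐ (b *ₚ ((s *ₚ a) +ₚ (X *ₚ (s *ₚ A))))
  expand = solve-∀ ℤ[x]
  regroup : ∀ b sa X Q B R σ → (b *ₚ (sa +ₚ (X *ₚ ((Q *ₚ B) +ₚ R))))
    ≐ ((((b *ₚ (X *ₚ Q)) +ₚ σ) *ₚ B) +ₚ ((b *ₚ (sa +ₚ (X *ₚ R))) +ₚ (-ₚ (σ *ₚ B))))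
  regroup = solve-∀ ℤ[x]
  equation : (K (b ℤ.* s) *ₚ (a ∷ A)) ≐ ((((K b *ₚ (Xₚ *ₚ Q)) +ₚ K σ) *ₚ B) +ₚ ((K b *ₚ S) +ₚ (-ₚ (K σ *ₚ B))))
  equation = begin
    K (b ℤ.* s) *ₚ (a ∷ A)                       ≈⟨ *ₚ-cong (≐-sym (K-*ₚ-K b s)) (∷-as-sum a A) ⟩
    (K b *ₚ K s) *ₚ (K a +ₚ (Xₚ *ₚ A))           ≈⟨ expand (K b) (K s) (K a) Xₚ A ⟩
    K b *ₚ ((K s *ₚ K a) +ₚ (Xₚ *ₚ (K s *ₚ A)))  ≈⟨ *ₚ-congˡ (K b) (+ₚ-congˡ (K s *ₚ K a) (*ₚ-congˡ Xₚ sA≐QB+R)) ⟩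
    K b *ₚ ((K s *ₚ K a) +ₚ (Xₚ *ₚ ((Q *ₚ B) +ₚ R))) ≈⟨ regroup (K b) (K s *ₚ K a) Xₚ Q B R (K σ) ⟩
    (((K b *ₚ (Xₚ *ₚ Q)) +ₚ K σ) *ₚ B) +ₚ ((K b *ₚ S) +ₚ (-ₚ (K σ *ₚ B))) ∎

coprime-back : ∀ {A B R s Q} → (K s *ₚ A) ≐ ((Q *ₚ B) +ₚ R) → Coprime B R → Coprime A B
coprime-back {A} {B} {R} {s} {Q} sA≐QB+R (bezout u v c c≢0 uB+vR≐c) =
  bezout (v *ₚ K s) (u +ₚ (-ₚ (v *ₚ Q))) c c≢0 (begin
    ((v *ₚ K s) *ₚ A) +ₚ ((u +ₚ (-ₚ (v *ₚ Q))) *ₚ B) ≈⟨ expand u v (K s) A B Q ⟩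
    ((u *ₚ B) +ₚ (v *ₚ (K s *ₚ A))) +ₚ (-ₚ (v *ₚ (Q *ₚ B)))
      ≈⟨ +ₚ-congʳ (-ₚ (v *ₚ (Q *ₚ B))) (+ₚ-congˡ (u *ₚ B) (*ₚ-congˡ v sA≐QB+R)) ⟩
    ((u *ₚ B) +ₚ (v *ₚ ((Q *ₚ B) +ₚ R))) +ₚ (-ₚ (v *ₚ (Q *ₚ B))) ≈⟨ cancel u v B (Q *ₚ B) R ⟩
    (u *ₚ B) +ₚ (v *ₚ R) ≈⟨ uB+vR≐c ⟩
    K c ∎)
  where
  open ≐-Reasoning
  expand : ∀ u v s A B Q → (((v *ₚ s) *ₚ A) +ₚ ((u +ₚ (-ₚ (v *ₚ Q))) *ₚ B))
    ≐ (((u *ₚ B) +ₚ (v *ₚ (s *ₚ A))) +ₚ (-ₚ (v *ₚ (Q *ₚ B))))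
  expand = solve-∀ ℤ[x]
  cancel : ∀ u v B QB R → (((u *ₚ B) +ₚ (v *ₚ (QB +ₚ R))) +ₚ (-ₚ (v *ₚ QB))) ≐ ((u *ₚ B) +ₚ (v *ₚ R))
  cancel = solve-∀ ℤ[x]

common-factor-back : ∀ {A B R s Q} → s ≢ 0ℤ → (K s *ₚ A) ≐ ((Q *ₚ B) +ₚ R) → CommonFactor B R → CommonFactor A B
common-factor-back {Q = Q} s≢0 sA≐QB+R (G , G-deg , G∣B , G∣R) =
  G , G-deg , ∣ℚ-cancel s≢0 (∣ℚ-resp (∣ℚ-+ (∣ℚ-*ˡ Q G∣B) G∣R) (≐-sym sA≐QB+R)) , G∣B

-- x has degree 1 (a common factor of A = 0 and B = 0).
Xₚ-degree : HasDegree Xₚ 1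
Xₚ-degree = (λ ()) , λ { zero () ; (suc zero) (s≤s ()) ; (suc (suc i)) _ → refl }

euclid-base : ∀ A {B} → B ≐ [] → Coprime A B ⊎ CommonFactor A B
euclid-base A {B} B≐0 with zero-or-degree A
... | inj₁ A≐0           = inj₂ (Xₚ , (1 , ℕₚ.≤-refl , Xₚ-degree) , ∣ℚ-zero Xₚ A≐0 , ∣ℚ-zero Xₚ B≐0)
... | inj₂ (zero , A-deg)  = inj₁ (constant-coprime A B A-deg)
... | inj₂ (suc k , A-deg) = inj₂ (A , (suc k , s≤s z≤n , A-deg) , ∣ℚ-refl A , ∣ℚ-zero A B≐0)

euclid : ∀ n A B → Small n B → Coprime A B ⊎ CommonFactor A B
euclid zero    A B B-small = euclid-base A (mk≐ λ i → B-small i z≤n)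
euclid (suc n) A B B-small with zero-or-degree B
... | inj₁ B≐0         = euclid-base A B≐0
... | inj₂ (m , B-deg) with pseudo-divide {B} B-deg A
...   | s , s≢0 , Q , R , sA≐QB+R , R-small =
  ⊎-map (coprime-back {A} {B} {R} {s} {Q} sA≐QB+R) (common-factor-back {A} {B} {R} {s} {Q} s≢0 sA≐QB+R)
        (euclid n B R λ i n≤i → R-small i (ℕₚ.≤-trans (ℕₚ.≤-pred (degree<Small {B} B-deg B-small)) n≤i))

coprime-or-common-factor : ∀ A B → Coprime A B ⊎ CommonFactor A B
coprime-or-common-factor A B = euclid (length B) A B (Small-length B)

-- §5.  The formal derivative and a square-free criterion.

deriv : Poly → Poly
deriv []      = []
deriv (a ∷ q) = q +ₚ (0ℤ ∷ deriv q)

coeff-deriv : ∀ p i → coeff (deriv p) i ≡ + suc i ℤ.* coeff p (suc i)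
coeff-deriv []      i       = sym (ℤₚ.*-zeroʳ (+ suc i))
coeff-deriv (a ∷ q) zero    =
  trans (coeff-+ₚ q (0ℤ ∷ deriv q) 0) (trans (ℤₚ.+-identityʳ _) (sym (ℤₚ.*-identityˡ _)))
coeff-deriv (a ∷ q) (suc j) = begin
  coeff (q +ₚ (0ℤ ∷ deriv q)) (suc j)       ≡⟨ coeff-+ₚ q (0ℤ ∷ deriv q) (suc j) ⟩
  coeff q (suc j) ℤ.+ coeff (deriv q) j     ≡⟨ cong (ℤ._+_ (coeff q (suc j))) (coeff-deriv q j) ⟩
  coeff q (suc j) ℤ.+ + suc j ℤ.* coeff q (suc j)
    ≡⟨ cong (ℤ._+ (+ suc j ℤ.* coeff q (suc j))) (ℤₚ.*-identityˡ (coeff q (suc j))) ⟨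
  1ℤ ℤ.* coeff q (suc j) ℤ.+ + suc j ℤ.* coeff q (suc j) ≡⟨ ℤₚ.*-distribʳ-+ (coeff q (suc j)) 1ℤ (+ suc j) ⟨
  + suc (suc j) ℤ.* coeff q (suc j)         ∎
  where open ≡-Reasoning

deriv-cong : ∀ {p q} → p ≐ q → deriv p ≐ deriv q
deriv-cong {p} {q} p≐q = mk≐ λ i →
  trans (coeff-deriv p i) (trans (cong (+ suc i ℤ.*_) (coeff-≡ p≐q (suc i))) (sym (coeff-deriv q i)))

deriv-+ₚ : ∀ p q → deriv (p +ₚ q) ≐ (deriv p +ₚ deriv q)
deriv-+ₚ p q = mk≐ λ i → begin
  coeff (deriv (p +ₚ q)) i                          ≡⟨ coeff-deriv (p +ₚ q) i ⟩
  + suc i ℤ.* coeff (p +ₚ q) (suc i)                ≡⟨ cong (+ suc i ℤ.*_) (coeff-+ₚ p q (suc i)) ⟩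
  + suc i ℤ.* (coeff p (suc i) ℤ.+ coeff q (suc i)) ≡⟨ ℤₚ.*-distribˡ-+ (+ suc i) (coeff p (suc i)) (coeff q (suc i)) ⟩
  + suc i ℤ.* coeff p (suc i) ℤ.+ + suc i ℤ.* coeff q (suc i)
    ≡⟨ cong₂ ℤ._+_ (coeff-deriv p i) (coeff-deriv q i) ⟨
  coeff (deriv p) i ℤ.+ coeff (deriv q) i           ≡⟨ coeff-+ₚ (deriv p) (deriv q) i ⟨
  coeff (deriv p +ₚ deriv q) i                      ∎
  where open ≡-Reasoning

deriv-·ₚ : ∀ c p → deriv (c ·ₚ p) ≐ (K c *ₚ deriv p)
deriv-·ₚ c p = mk≐ λ i → begin
  coeff (deriv (c ·ₚ p)) i              ≡⟨ coeff-deriv (c ·ₚ p) i ⟩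
  + suc i ℤ.* coeff (c ·ₚ p) (suc i)    ≡⟨ cong (+ suc i ℤ.*_) (coeff-·ₚ c p (suc i)) ⟩
  + suc i ℤ.* (c ℤ.* coeff p (suc i))   ≡⟨ swap (+ suc i) c (coeff p (suc i)) ⟩
  c ℤ.* (+ suc i ℤ.* coeff p (suc i))   ≡⟨ cong (c ℤ.*_) (coeff-deriv p i) ⟨
  c ℤ.* coeff (deriv p) i               ≡⟨ coeff-K*ₚ c (deriv p) i ⟨
  coeff (K c *ₚ deriv p) i              ∎
  where
  open ≡-Reasoning
  swap : ∀ n c x → n ℤ.* (c ℤ.* x) ≡ c ℤ.* (n ℤ.* x)
  swap = ℤ-solve-∀

leibniz : ∀ p q → deriv (p *ₚ q) ≐ ((deriv p *ₚ q) +ₚ (p *ₚ deriv q))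
leibniz []      q = ≐-refl
leibniz (a ∷ p) q = begin
  deriv ((a ·ₚ q) +ₚ (0ℤ ∷ (p *ₚ q)))
    ≈⟨ deriv-+ₚ (a ·ₚ q) (0ℤ ∷ (p *ₚ q)) ⟩
  deriv (a ·ₚ q) +ₚ ((p *ₚ q) +ₚ (0ℤ ∷ deriv (p *ₚ q)))
    ≈⟨ +ₚ-cong (deriv-·ₚ a q) (+ₚ-congˡ (p *ₚ q)
         (≐-trans (∷-cong refl (leibniz p q)) (≐-sym (Xₚ-*ₚ _)))) ⟩
  (K a *ₚ deriv q) +ₚ ((p *ₚ q) +ₚ (Xₚ *ₚ ((deriv p *ₚ q) +ₚ (p *ₚ deriv q))))
    ≈⟨ regroup (K a) Xₚ p q (deriv p) (deriv q) ⟩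
  ((p +ₚ (Xₚ *ₚ deriv p)) *ₚ q) +ₚ ((K a +ₚ (Xₚ *ₚ p)) *ₚ deriv q)
    ≈⟨ +ₚ-cong (*ₚ-congʳ q (+ₚ-congˡ p (Xₚ-*ₚ (deriv p)))) (*ₚ-congʳ (deriv q) (≐-sym (∷-as-sum a p))) ⟩
  ((p +ₚ (0ℤ ∷ deriv p)) *ₚ q) +ₚ ((a ∷ p) *ₚ deriv q) ∎
  where
  open ≐-Reasoning
  regroup : ∀ a X p q p′ q′ → ((a *ₚ q′) +ₚ ((p *ₚ q) +ₚ (X *ₚ ((p′ *ₚ q) +ₚ (p *ₚ q′)))))
    ≐ (((p +ₚ (X *ₚ p′)) *ₚ q) +ₚ ((a +ₚ (X *ₚ p)) *ₚ q′))
  regroup = solve-∀ ℤ[x]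

-- A square factor of g is a factor of g′:  (h²k)′ = h·((h′ + h′)·k + h·k′).
square-factor-divides-deriv : ∀ h k g → (h *ₚ (h *ₚ k)) ≐ g → ∃ λ w → (h *ₚ w) ≐ deriv g
square-factor-divides-deriv h k g h²k≐g = ((deriv h +ₚ deriv h) *ₚ k) +ₚ (h *ₚ deriv k) , ≐-sym (begin
  deriv g                                              ≈⟨ deriv-cong (≐-sym h²k≐g) ⟩
  deriv (h *ₚ (h *ₚ k))                                ≈⟨ leibniz h (h *ₚ k) ⟩
  (deriv h *ₚ (h *ₚ k)) +ₚ (h *ₚ deriv (h *ₚ k))       ≈⟨ +ₚ-congˡ (deriv h *ₚ (h *ₚ k)) (*ₚ-congˡ h (leibniz h k)) ⟩
  (deriv h *ₚ (h *ₚ k)) +ₚ (h *ₚ ((deriv h *ₚ k) +ₚ (h *ₚ deriv k))) ≈⟨ factor h (deriv h) k (deriv k) ⟩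
  h *ₚ (((deriv h +ₚ deriv h) *ₚ k) +ₚ (h *ₚ deriv k)) ∎)
  where
  open ≐-Reasoning
  factor : ∀ h h′ k k′ → ((h′ *ₚ (h *ₚ k)) +ₚ (h *ₚ ((h′ *ₚ k) +ₚ (h *ₚ k′))))
    ≐ (h *ₚ (((h′ +ₚ h′) *ₚ k) +ₚ (h *ₚ k′)))
  factor = solve-∀ ℤ[x]

coprime-deriv⇒square-free : ∀ g → Coprime g (deriv g) → SquareFree g
coprime-deriv⇒square-free g g⊥g′ (h , h-nonconstant , k , h²k≈g) =
  coprime⇒no-common-factor {h = h} {w₁ = h *ₚ k} {w₂ = proj₁ h∣g′} g⊥g′
    (nonzero-coeff⇒DegreeAtLeast {p = h} h-nonconstant) h²k≐g (proj₂ h∣g′)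
  where
  h²k≐g : (h *ₚ (h *ₚ k)) ≐ g
  h²k≐g = ≐-trans (≐-sym (*ₚ-assoc h h k)) (≈ₚ⇒≐ _ _ h²k≈g)
  h∣g′ : ∃ λ w → (h *ₚ w) ≐ deriv g
  h∣g′ = square-factor-divides-deriv h k g h²k≐g

deriv-addConst : ∀ t f → deriv (addConst t f) ≐ deriv f
deriv-addConst t []      = mk≐ λ { zero → refl ; (suc i) → refl }
deriv-addConst t (a ∷ f) = ≐-refl

-- Differentiation lowers the degree by one (in characteristic zero).
HasDegree-deriv : ∀ {f n} → HasDegree f (suc n) → HasDegree (deriv f) n
HasDegree-deriv {f} {n} (lead , high) =
  (λ e → *-≢0 {+ suc n} {coeff f (suc n)} (λ ()) lead (trans (sym (coeff-deriv f n)) e)) ,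
  λ i n<i → trans (coeff-deriv f i) (trans (cong (+ suc i ℤ.*_) (high (suc i) (s≤s n<i))) (ℤₚ.*-zeroʳ (+ suc i)))

-- §6.  Factors shared with many shifts make a divisor of large degree.

-- If for each i < N
-- the polynomials f + t(i) and F share a factor Gᵢ of positive degree, then,
-- as distinct shifts differ by a nonzero constant, the Gᵢ are pairwise
-- coprime, so G₀⋯G_{N−1} divides F; hence N ≤ deg F.
module SharedFactors (f F : Poly) (t : ℕ → ℤ) (t-injective : ∀ {i j} → t i ≡ t j → i ≡ j) where

  shift : ℕ → Poly
  shift i = f +ₚ K (t i)

  SharedFactor : ℕ → Set
  SharedFactor i = ∃ λ G → DegreeAtLeast 1 G × G ∣ℚ shift i × G ∣ℚ F

  record Product (n : ℕ) : Set where
    field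
      poly          : Poly
      degree        : DegreeAtLeast n poly
      divides-F     : poly ∣ℚ F
      coprime-later : ∀ i → n ≤ i → Coprime poly (shift i)

  empty : Product 0
  empty = record
    { poly          = oneₚ
    ; degree        = 0 , z≤n , K-degree (λ ())
    ; divides-F     = divides 1ℤ (λ ()) F ≐-refl
    ; coprime-later = λ i _ → constant-coprime oneₚ (shift i) (K-degree (λ ()))
    }

  -- Gₙ divides shift n, to which the product so far is coprime; so the two
  -- are coprime and their product still divides F.  Gₙ is coprime to every
  -- later shift, hence so is the new product.
  extend : ∀ {n} → Product n → SharedFactor n → Product (suc n)
  extend {n} Pₙ (G , G-deg , G∣shiftₙ , G∣F) = record
    { poly          = P *ₚ G
    ; degree        = subst (λ d → DegreeAtLeast d (P *ₚ G)) (ℕₚ.+-comm n 1) (DegreeAtLeast-*ₚ P G degree G-deg)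
    ; divides-F     = ∣ℚ-*ₚ divides-F G∣F (coprime-∣ℚ (coprime-later n ℕₚ.≤-refl) G∣shiftₙ)
    ; coprime-later = λ i n<i → coprime-*ₚ (coprime-later i (ℕₚ.<⇒≤ n<i))
        (coprime-shift {G} {f} G∣shiftₙ λ tₙ≡tᵢ → ℕₚ.<⇒≢ n<i (t-injective tₙ≡tᵢ))
    }
    where open Product Pₙ renaming (poly to P)

  product : ∀ N → (∀ i → i < N → SharedFactor i) → Product N
  product zero    _      = empty
  product (suc N) shared = extend (product N λ i i<N → shared i (ℕₚ.m<n⇒m<1+n i<N)) (shared N ℕₚ.≤-refl)

  few-shared-factors : ∀ {N n} → HasDegree F n → (∀ i → i < N → SharedFactor i) → N ≤ n
  few-shared-factors {N} F-deg shared with product N shared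
  ... | record { degree = _ , N≤k , P-deg ; divides-F = P∣F } = ℕₚ.≤-trans N≤k (degree-of-∣ℚ P-deg F-deg P∣F)

search : ∀ {A B : ℕ → Set} N → (∀ i → A i ⊎ B i) → (∃ λ i → i < N × A i) ⊎ (∀ i → i < N → B i)
search zero    decide = inj₂ λ _ ()
search (suc N) decide with search N decide | decide N
... | inj₁ (i , i<N , Aᵢ) | _      = inj₁ (i , ℕₚ.m<n⇒m<1+n i<N , Aᵢ)
... | inj₂ B-below      | inj₁ Aₙ = inj₁ (N , ℕₚ.≤-refl , Aₙ)
... | inj₂ B-below      | inj₂ Bₙ = inj₂ λ i i<1+N → [ B-below i , (λ { refl → Bₙ }) ]′ (ℕₚ.m<1+n⇒m<n∨m≡n i<1+N)

shift-injective : ∀ m {i j} → + i ℤ.- + m ≡ + j ℤ.- + m → i ≡ j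
shift-injective m {i} {j} eq = ℤₚ.+-injective (+-cancelʳ (ℤ.- + m) (+ i) (+ j) eq)

shift-bound : ∀ m i → i ≤ m + m → ∣ + i ℤ.- + m ∣ ≤ m
shift-bound m i i≤2m rewrite ℤₚ.m-n≡m⊖n i m with i ℕₚ.≤? m
... | yes i≤m rewrite ℤₚ.⊖-≤ i≤m | ℤₚ.∣-i∣≡∣i∣ (+ (m ∸ i)) = ℕₚ.m∸n≤m m i
... | no  i≰m rewrite ℤₚ.⊖-≥ (ℕₚ.<⇒≤ (ℕₚ.≰⇒> i≰m)) = ℕₚ.m≤n+o⇒m∸n≤o i m i≤2m

-- There are 2⌊d/2⌋ + 1 ≥ d such shifts.
half-bound : ∀ d → d ≤ suc (⌊ d /2⌋ + ⌊ d /2⌋)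
half-bound d = begin
  d                         ≡⟨ ℕₚ.⌊n/2⌋+⌈n/2⌉≡n d ⟨
  ⌊ d /2⌋ + ⌈ d /2⌉         ≤⟨ ℕₚ.+-monoʳ-≤ ⌊ d /2⌋ (ℕₚ.⌊n/2⌋-mono (ℕₚ.n≤1+n (suc d))) ⟩
  ⌊ d /2⌋ + suc ⌊ d /2⌋     ≡⟨ ℕₚ.+-suc ⌊ d /2⌋ ⌊ d /2⌋ ⟩
  suc (⌊ d /2⌋ + ⌊ d /2⌋)   ∎
  where open ℕₚ.≤-Reasoning

-- A constant f is coprime to its derivative.
theorem1p2 : (f : Poly) (d : ℕ) → HasDegree f d →
    ∃ λ (t : ℤ) → (∣ t ∣ ≤ ⌊ d /2⌋) × SquareFree (addConst t f)
theorem1p2 f zero    f-deg = 0ℤ , z≤n , coprime-deriv⇒square-free (addConst 0ℤ f)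
  (constant-coprime (addConst 0ℤ f) _ (HasDegree-resp {f} (≐-sym (addConst-zero f)) f-deg))
theorem1p2 f (suc d) f-deg =
  [ square-free-shift , ⊥-elim ∘ all-shifts-share-factors ]′
    (search N λ i → coprime-or-common-factor (g i) (deriv (g i)))
  where
  m N : ℕ
  m = ⌊ suc d /2⌋
  N = suc (m + m)
  t : ℕ → ℤ
  t i = + i ℤ.- + m
  g : ℕ → Poly
  g i = addConst (t i) f
  open SharedFactors f (deriv f) t (shift-injective m)

  square-free-shift : (∃ λ i → i < N × Coprime (g i) (deriv (g i))) → ∃ λ t → ∣ t ∣ ≤ m × SquareFree (addConst t f)
  square-free-shift (i , s≤s i≤2m , g⊥g′) = t i , shift-bound m i i≤2m , coprime-deriv⇒square-free (g i) g⊥g′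

  all-shifts-share-factors : (∀ i → i < N → CommonFactor (g i) (deriv (g i))) → ⊥
  all-shifts-share-factors common = ℕₚ.<⇒≱ (half-bound (suc d)) (few-shared-factors (HasDegree-deriv {f} f-deg) shared)
    where
    shared : ∀ i → i < N → SharedFactor i
    shared i i<N with common i i<N
    ... | G , G-deg , G∣g , G∣g′ = G , G-deg , ∣ℚ-resp G∣g (addConst-as-sum (t i) f) , ∣ℚ-resp G∣g′ (deriv-addConst (t i) f)
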